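{- (Relevant Karp's Theorem) Let $(M_1,w_1)$ and $(M_2,w_2)$ be two pointed Routley–Meyer models and $\{i,j\}=\{1,2\}$. Then the following are equivalent: (i) for every formula $\phi$ of $L_{\infty\omega}^{\rightarrow}$, $M_i,w_i\Vdash\phi$ only if $M_j,w_j\Vdash\phi$; (ii) there is a relevant directed bisimulation $\langle Z_1,Z_2\rangle$ for $\mathtt{PROP}$ between $M_1$ and $M_2$ such that $w_iZ_iw_j$.
   Context: Language. Given a set $\mathtt{PROP}$ of propositional variables, the formulas of $L_{\infty\omega}^{\rightarrow}$ are generated by $\phi ::= p \mid \bot \mid {\sim}\phi \mid \bigwedge_{i\in I}\phi_i \mid \bigvee_{i\in I}\phi_i \mid \phi\rightarrow\psi$, with $p\in\mathtt{PROP}$ and $I$ an arbitrary set. Models. A (Routley–Meyer) model is $M=\langle W,R,*,T,V\rangle$ with $W$ a non-empty set, $T\in W$ (often omitted), $*:W\to W$ (written $w\mapsto w^*$), $R\subseteq W^3$, and $V:\mathtt{PROP}\to\wp(W)$. A pointed model is a pair $(M,w)$ with $w\in W$. Satisfaction: $M,w\Vdash\bot$ never; $M,w\Vdash p$ iff $w\in V(p)$; $M,w\Vdash{\sim}\phi$ iff $M,w^*\nVdash\phi$; $M,w\Vdash\bigwedge_{i\in I}\phi_i$ iff $M,w\Vdash\phi_i$ for every $i\in I$; $M,w\Vdash\bigvee_{i\in I}\phi_i$ iff $M,w\Vdash\phi_i$ for some $i\in I$; $M,w\Vdash\phi\rightarrow\psi$ iff for all $a,b$ with $Rwab$, if $M,a\Vdash\phi$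 then $M,b\Vdash\psi$. Relevant directed bisimulations. Let $M_1=\langle W_1,R_1,*_1,V_1\rangle$ and $M_2=\langle W_2,R_2,*_2,V_2\rangle$ be models. A relevant directed bisimulation for $\mathtt{PROP}$ between $M_1$ and $M_2$ is a pair $\langle Z_1,Z_2\rangle$ of non-empty relations $Z_1\subseteq W_1\times W_2$, $Z_2\subseteq W_2\times W_1$ such that whenever $\{i,j\}=\{1,2\}$: (1) $xZ_iy$ only if $y^{*_j}Z_jx^{*_i}$; (2) if $xZ_iy$ and $R_jybc$ for some $b,c\in W_j$, there are $b',c'\in W_i$ such that $R_ixb'c'$, $bZ_jb'$ and $c'Z_ic$; (3) if $xZ_iy$ and $p\in\mathtt{PROP}$, then $M_i,x\Vdash p$ only if $M_j,y\Vdash p$. -}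

module Defs where

open import Data.Empty.Polymorphic using (⊥)
open import Data.Product using (∃; ∃₂; _×_)
open import Level using (Level; suc)
open import Relation.Binary.Core using (REL)
open import Relation.Nullary using (¬_)
open import Relation.Unary using (Pred; _∈_)

private
  variable
    ℓ : Level

-- "Set" in the informal sense is read as Set ℓ for one fixed but arbitrary ℓ:
-- the variables, the index types of ⋀ and ⋁, and the worlds all live there.
-- The formulas form a proper class, hence live in Set (suc ℓ).

infixr 5 _⇒_
infix  8 ∼_

data Formula (PROP : Set ℓ) : Set (suc ℓ) where
  var  : PROP → Formula PROP
  bot  : Formula PROP
  ∼_   : Formula PROP → Formula PROP
  ⋀ ⋁  : (I : Set ℓ) → (I → Formula PROP) → Formula PROP
  _⇒_  : Formula PROP → Formula PROP → Formula PROP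

-- No frame conditions are imposed. W is non-empty because it contains T.
record Model (PROP : Set ℓ) : Set (suc ℓ) where
  infix 9 _⋆
  field
    W  : Set ℓ
    R  : W → W → W → Set ℓ
    _⋆ : W → W
    T  : W
    V  : PROP → Pred W ℓ

open Model public using (W)

infix 4 _,_⊩_

_,_⊩_ : {PROP : Set ℓ} (M : Model PROP) → W M → Formula PROP → Set ℓ
M , w ⊩ var p   = w ∈ Model.V M p
M , w ⊩ bot     = ⊥
M , w ⊩ ∼ φ     = ¬ (M , Model._⋆ M w ⊩ φ)
M , w ⊩ ⋀ I φ   = (i : I) → M , w ⊩ φ i
M , w ⊩ ⋁ I φ   = ∃ λ (i : I) → M , w ⊩ φ i
M , w ⊩ φ ⇒ ψ   = ∀ a b → Model.R M w a b → M , a ⊩ φ → M , b ⊩ ψ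

-- The conditions on ⟨Z₁ , Z₂⟩ for one of the two choices of {i , j} = {1 , 2}.
record Directed {PROP : Set ℓ} (Mᵢ Mⱼ : Model PROP)
                (Zᵢ : REL (W Mᵢ) (W Mⱼ) ℓ) (Zⱼ : REL (W Mⱼ) (W Mᵢ) ℓ) : Set ℓ where
  private
    module Mᵢ = Model Mᵢ
    module Mⱼ = Model Mⱼ
  field
    star : ∀ {x y} → Zᵢ x y → Zⱼ (y Mⱼ.⋆) (x Mᵢ.⋆)
    back : ∀ {x y b c} → Zᵢ x y → Mⱼ.R y b c →
           ∃₂ λ b′ c′ → Mᵢ.R x b′ c′ × Zⱼ b b′ × Zᵢ c′ c
    atom : ∀ {x y} → Zᵢ x y → ∀ p → Mᵢ , x ⊩ var p → Mⱼ , y ⊩ var p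

record RelevantDirectedBisimulation {PROP : Set ℓ} (M₁ M₂ : Model PROP) : Set (suc ℓ) where
  field
    Z₁          : REL (W M₁) (W M₂) ℓ
    Z₂          : REL (W M₂) (W M₁) ℓ
    Z₁-nonempty : ∃₂ λ x y → Z₁ x y
    Z₂-nonempty : ∃₂ λ x y → Z₂ x y
    directed₁₂  : Directed M₁ M₂ Z₁ Z₂
    directed₂₁  : Directed M₂ M₁ Z₂ Z₁

{-# OPTIONS --safe #-}
-- (ii) ⇒ (i) is an induction on formulas. For (i) ⇒ (ii), preservation of all
-- formulas, taken in both directions, is itself a directed bisimulation. If
-- its back condition failed at x, y, b, c, then the conjunction χ of formulas
-- true at b and the disjunction ψ of formulas false at c, each chosen to
-- separate as many worlds of the other model as possible, would give χ ⇒ ψ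
-- true at x and false at y. Both are indexed by a set of worlds, so they are
-- formulas although the formulas form a proper class.
module Submission where

open import Defs
open import Axiom.ExcludedMiddle using (ExcludedMiddle)
open import Data.Empty.Polymorphic using (⊥; ⊥-elim)
open import Data.Product using (∃; ∃₂; _×_; _,_)
open import Function.Base using (_∘_)
open import Function.Bundles using (_⇔_; mk⇔)
open import Level using (Level; suc; Lift; lift; lower)
open import Relation.Binary.Core using (REL)
open import Relation.Nullary using (¬_; Dec; yes; no; contradiction)
open import Relation.Nullary.Decidable using (True; toWitness; fromWitness; map′; decidable-stable)

private
  variable
    ℓ : Level
    PROP : Set ℓ

swap : {M₁ M₂ : Model PROP} →
       RelevantDirectedBisimulation M₁ M₂ → RelevantDirectedBisimulation M₂ M₁
swap B = record
  { Z₁ = Z₂ ; Z₂ = Z₁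
  ; Z₁-nonempty = Z₂-nonempty ; Z₂-nonempty = Z₁-nonempty
  ; directed₁₂ = directed₂₁ ; directed₂₁ = directed₁₂
  }
  where open RelevantDirectedBisimulation B

-- Both directions enter one induction because `∼` and the antecedent of `⇒` reverse the direction
-- of transfer, so `D` and `D′` trade places there.
preserves : {M N : Model PROP} {Z : REL (W M) (W N) _} {Z′ : REL (W N) (W M) _} →
            Directed M N Z Z′ → Directed N M Z′ Z →
            ∀ φ {x y} → Z x y → M , x ⊩ φ → N , y ⊩ φ
preserves D D′ (var p) xZy = Directed.atom D xZy p
preserves D D′ (∼ φ) xZy x*⊮φ = x*⊮φ ∘ preserves D′ D φ (Directed.star D xZy)
preserves D D′ (⋀ I φ) xZy f i = preserves D D′ (φ i) xZy (f i)
preserves D D′ (⋁ I φ) xZy (i , x⊩φᵢ) = i , preserves D D′ (φ i) xZy x⊩φᵢ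
preserves D D′ (φ ⇒ ψ) xZy x⊩φ⇒ψ b c Rybc b⊩φ
  with b′ , c′ , Rxb′c′ , bZ′b′ , c′Zc ← Directed.back D xZy Rybc =
  preserves D D′ ψ c′Zc (x⊩φ⇒ψ b′ c′ Rxb′c′ (preserves D′ D φ bZ′b′ b⊩φ))

lowerEM : ExcludedMiddle (suc ℓ) → ExcludedMiddle ℓ
lowerEM {ℓ} em {P} = map′ lower lift (em {Lift (suc ℓ) P})

module Classical {ℓ : Level} (em : ExcludedMiddle (suc ℓ)) {PROP : Set ℓ} where

  Preserves : (M N : Model PROP) → W M → W N → Set (suc ℓ)
  Preserves M N x y = ∀ φ → M , x ⊩ φ → N , y ⊩ φ

  -- Deciding the large proposition Preserves M N x y brings it down to Set ℓ.
  Preserved : (M N : Model PROP) → REL (W M) (W N) ℓ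
  Preserved M N x y = Lift ℓ (True (em {Preserves M N x y}))

  toPreserves : ∀ M N {x y} → Preserved M N x y → Preserves M N x y
  toPreserves M N (lift t) = toWitness t

  fromPreserves : ∀ M N {x y} → Preserves M N x y → Preserved M N x y
  fromPreserves M N p = lift (fromWitness p)

  dne : {P : Set ℓ} → ¬ ¬ P → P
  dne = decidable-stable (lowerEM em)

  -- Excluded middle decides the type of witnesses itself, so it also serves as
  -- the choice principle that picks a formula for each pair of worlds.
  Separable : (M N : Model PROP) → W M → W N → Set (suc ℓ)
  Separable M N x y = ∃ λ φ → M , x ⊩ φ × ¬ (N , y ⊩ φ)

  inseparable⇒preserved : ∀ M N {x y} → ¬ Separable M N x y → Preserved M N x y
  inseparable⇒preserved M N ¬sep =
    fromPreserves M N λ φ x⊩φ → dne λ y⊮φ → ¬sep (φ , x⊩φ , y⊮φ)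

  -- The decision is an argument so that a later `with em` can abstract it and let this reduce.
  separatorOr : ∀ {M N : Model PROP} {x y} → Formula PROP → Dec (Separable M N x y) → Formula PROP
  separatorOr default (yes (φ , _)) = φ
  separatorOr default (no _)        = default

  top : Formula PROP
  top = ⋀ ⊥ ⊥-elim

  module _ (M N : Model PROP) where

    -- The defaults `top` and `bot` are neutral for `⋀` and `⋁`, so inseparable worlds contribute
    -- nothing.
    positive : W M → Formula PROP
    positive x = ⋀ (W N) λ y → separatorOr top (em {Separable M N x y})

    negative : W N → Formula PROP
    negative y = ⋁ (W M) λ x → separatorOr bot (em {Separable M N x y})

    positive-holds : ∀ x → M , x ⊩ positive x
    positive-holds x y with em {Separable M N x y}
    ... | yes (_ , x⊩φ , _) = x⊩φ
    ... | no _              = λ ()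

    -- The conjunct indexed by `y` itself would fail at `y` if any formula separated `x` from `y`.
    positive⇒preserved : ∀ {x y} → N , y ⊩ positive x → Preserved M N x y
    positive⇒preserved {x} {y} y⊩ with em {Separable M N x y} | y⊩ y
    ... | yes (_ , _ , y⊮φ) | y⊩φ = contradiction y⊩φ y⊮φ
    ... | no ¬sep           | _   = inseparable⇒preserved M N ¬sep

    negative-fails : ∀ y → ¬ (N , y ⊩ negative y)
    negative-fails y (x , y⊩φ) with em {Separable M N x y}
    negative-fails y (x , y⊩φ) | yes (_ , _ , y⊮φ) = y⊮φ y⊩φ
    negative-fails y (x , ())  | no _

    ¬negative⇒preserved : ∀ {x y} → ¬ (M , x ⊩ negative y) → Preserved M N x y
    ¬negative⇒preserved {x} {y} x⊮ = inseparable⇒preserved M N λ sep → x⊮ (x , holds sep)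
      where
      holds : Separable M N x y → M , x ⊩ separatorOr bot (em {Separable M N x y})
      holds sep with em {Separable M N x y}
      -- The disjunct at `x` is the formula chosen by `em`, which need not be the one in `sep`.
      ... | yes (_ , x⊩φ , _) = x⊩φ
      ... | no ¬sep           = contradiction sep ¬sep

  preserved-star : ∀ M N {x y} → Preserved M N x y →
                   Preserved N M (Model._⋆ N y) (Model._⋆ M x)
  preserved-star M N xZy = fromPreserves N M λ φ y*⊩φ →
    -- Preservation of `∼ φ` from `x` to `y` is the contrapositive of preservation of `φ` from `y*`
    -- to `x*`.
    dne λ x*⊮φ → toPreserves M N xZy (∼ φ) x*⊮φ y*⊩φ

  preserved-directed : ∀ M N → Directed M N (Preserved M N) (Preserved N M)
  preserved-directed M N = record
    { star = preserved-star M N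
    ; back = back
    ; atom = λ xZy p → toPreserves M N xZy (var p)
    }
    where
    back : ∀ {x y b c} → Preserved M N x y → Model.R N y b c →
           ∃₂ λ b′ c′ → Model.R M x b′ c′ × Preserved N M b b′ × Preserved M N c′ c
    back {x} {y} {b} {c} xZy Rybc = dne λ none →
      negative-fails M N c
        -- The model arguments are reversed in the antecedent because `b` must be related to `b′`,
        -- but `c′` to `c`.
        (toPreserves M N xZy (positive N M b ⇒ negative M N c)
          (λ b′ c′ Rxb′c′ b′⊩ → dne λ c′⊮ →
            none (b′ , c′ , Rxb′c′ , positive⇒preserved N M b′⊩ , ¬negative⇒preserved M N c′⊮))
          b c Rybc (positive-holds N M b))

  preserves⇒bisimilar : ∀ M N {x y} → Preserves M N x y →
    ∃ λ (B : RelevantDirectedBisimulation M N) → RelevantDirectedBisimulation.Z₁ B x y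
  preserves⇒bisimilar M N p = record
    { Z₁ = Preserved M N
    ; Z₂ = Preserved N M
    ; Z₁-nonempty = _ , _ , xZy
    -- The star condition turns the given pair into one for the other relation.
    ; Z₂-nonempty = _ , _ , preserved-star M N xZy
    ; directed₁₂ = preserved-directed M N
    ; directed₂₁ = preserved-directed N M
    } , xZy
    where xZy = fromPreserves M N p

theorem7 : ∀ {ℓ : Level} → ExcludedMiddle (suc ℓ) →
    (PROP : Set ℓ) (M₁ M₂ : Model PROP) (w₁ : W M₁) (w₂ : W M₂) →
    ((∀ (φ : Formula PROP) → M₁ , w₁ ⊩ φ → M₂ , w₂ ⊩ φ)
    ⇔ (∃ λ (B : RelevantDirectedBisimulation M₁ M₂) → RelevantDirectedBisimulation.Z₁ B w₁ w₂))
    × ((∀ (φ : Formula PROP) → M₂ , w₂ ⊩ φ → M₁ , w₁ ⊩ φ)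
    ⇔ (∃ λ (B : RelevantDirectedBisimulation M₁ M₂) → RelevantDirectedBisimulation.Z₂ B w₂ w₁))
theorem7 em PROP M₁ M₂ w₁ w₂ =
    mk⇔ (preserves⇒bisimilar M₁ M₂)
        (λ (B , w₁Zw₂) φ → preserves (directed₁₂ B) (directed₂₁ B) φ w₁Zw₂)
  -- The conditions are symmetric in the two indices, so exchanging the models gives the other
  -- choice of indices.
  , mk⇔ (λ p → let (B , w₂Zw₁) = preserves⇒bisimilar M₂ M₁ p in swap B , w₂Zw₁)
        (λ (B , w₂Zw₁) φ → preserves (directed₂₁ B) (directed₁₂ B) φ w₂Zw₁)
  where
  open Classical em
  open RelevantDirectedBisimulation
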